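{- Let $G$ be a graph of order $n$, and let $k$ be an integer with $\mathrm{Z}_+(G)\leq k\leq n$. Then $\mathrm{pt}_+(G,k)\leq\left\lceil\frac{n-k}{2}\right\rceil$.
   Context: Graphs are finite and simple. In PSD forcing each vertex is blue or white. PSD color change rule: let $B$ be the current set of blue vertices and let $W_1,\dots,W_r$ be the vertex sets of the components of $G-B$; if $u\in B$, $w\in W_i$, and $w$ is the only white neighbor of $u$ in $G[W_i\cup B]$, then $w$ may be colored blue ($u$ forces $w$). A set $B\subseteq V(G)$ is a PSD forcing set if starting with exactly $B$ blue, repeated application of the rule colors all of $V(G)$ blue; $\mathrm{Z}_+(G)$ is the minimum size of a PSD forcing set. Given an initial blue set $B$, set $B^{[0]}=B$ and, for $i\ge0$, let $B^{[i+1]}$ be $B^{[i]}$ together with all vertices that can be PSD forced by some vertex when exactly $B^{[i]}$ is blue. The PSD propagation time $\mathrm{pt}_+(G;B)$ is the least $t$ with $B^{[t]}=V(G)$ (infinity if no such $t$). For an integer $k$, $\mathrm{pt}_+(G,k)=\min_{|B|=k}\mathrm{pt}_+(G;B)$, and $\mathrm{pt}_+(G)=\mathrm{pt}_+(G,\mathrm{Z}_+(G))$. -}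

module Defs where

open import Data.Nat using (ℕ; zero; suc; _≤_; ⌈_/2⌉; _∸_)
open import Data.Bool using (Bool; true; false; T)
open import Data.Fin using (Fin)
open import Data.Fin.Subset using (Subset; _∈_; ∣_∣)
open import Data.Product using (Σ; ∃; _×_; _,_)
open import Data.Sum using (_⊎_)
open import Relation.Nullary using (¬_)
open import Relation.Binary.PropositionalEquality using (_≡_)

record Graph (n : ℕ) : Set where
  field
    adj     : Fin n → Fin n → Bool
    sym     : ∀ u v → adj u v ≡ adj v u
    irrefl  : ∀ v → adj v v ≡ false

open Graph public

Adj : ∀ {n} → Graph n → Fin n → Fin n → Set
Adj G u v = T (adj G u v)

data Conn {n} (G : Graph n) (W : Fin n → Set) (w : Fin n) : Fin n → Set where
  here : W w → Conn G W w w
  step : ∀ {y x} → Conn G W w y → W x → Adj G y x → Conn G W w x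

Forces : ∀ {n} → Graph n → (Fin n → Set) → Fin n → Fin n → Set
Forces G Blue u w =
  Blue u × ¬ Blue w × Adj G u w ×
  (∀ x → ¬ Blue x → Adj G u x → Conn G (λ v → ¬ Blue v) w x → x ≡ w)

BlueAt : ∀ {n} → Graph n → Subset n → ℕ → Fin n → Set
BlueAt G B zero    v = v ∈ B
BlueAt G B (suc i) v = BlueAt G B i v ⊎ ∃ (λ u → Forces G (BlueAt G B i) u v)

-- pt_+(G;B) ≤ t  iff  B^[t] = V(G)
PtLE : ∀ {n} → Graph n → Subset n → ℕ → Set
PtLE G B t = ∀ v → BlueAt G B t v

IsPSDForcingSet : ∀ {n} → Graph n → Subset n → Set
IsPSDForcingSet G B = ∃ (λ t → PtLE G B t)

IsZplus : ∀ {n} → Graph n → ℕ → Set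
IsZplus G z =
  (∃ (λ B → ∣ B ∣ ≡ z × IsPSDForcingSet G B)) ×
  (∀ B → IsPSDForcingSet G B → z ≤ ∣ B ∣)

-- pt_+(G,k) ≤ t : some B with |B| = k has pt_+(G;B) ≤ t
PtKLE : ∀ {n} → Graph n → ℕ → ℕ → Set
PtKLE G k t = ∃ (λ B → ∣ B ∣ ≡ k × PtLE G B t)

-- Fix a PSD forcing set B with |B| = k and put c = ⌈(n-k)/2⌉.  White components
-- do not interact, so a component of size at most c turns blue within c steps.
-- If some white component C has more than c vertices, take a force u → w with w in C
-- and replace u by w in B.  The only neighbour of u in C is w, so w forces u back:
-- the new set is again a forcing set, the at most c white vertices outside C - w
-- are separated from C - w, and only the smaller set C - w remains to be treated.
{-# OPTIONS --safe #-}
module Submission where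

open import Defs
open import Data.Nat using (ℕ; zero; suc; _+_; _≤_; _<_; _∸_; ⌈_/2⌉; ⌊_/2⌋; z≤n; s≤s; s≤s⁻¹)
open import Data.Nat.Properties
open import Data.Bool using (T)
open import Data.Bool.Properties using (T?)
open import Data.Fin using (Fin)
open import Data.Fin.Properties using (any?; all?) renaming (_≟_ to _≟ᶠ_)
open import Data.Fin.Subset using (Subset; inside; outside; _∈_; _∉_; _⊆_; ∣_∣; _∪_; _─_; _-_; ∁; ⁅_⁆; Nonempty)
open import Data.Fin.Subset.Properties
open import Data.Product using (∃; ∃-syntax; _×_; _,_; proj₁; proj₂)
open import Data.Sum using (_⊎_; inj₁; inj₂; [_,_]′)
open import Data.Vec using ([]; _∷_; here; there)
open import Function using (_∘_; id)
open import Relation.Nullary using (¬_; Dec; yes; no; contradiction)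
open import Relation.Nullary.Decidable using (¬?; _×-dec_; _⊎-dec_; _→-dec_; map′; decidable-stable)
open import Relation.Unary using (Decidable)
open import Relation.Binary.PropositionalEquality using (_≡_; _≢_; refl; cong; subst; trans; module ≡-Reasoning) renaming (sym to ≡-sym)

-- Cardinalities of finite subsets.

x∈p─q⇒x∉q : ∀ {n} {x : Fin n} (p q : Subset n) → x ∈ p ─ q → x ∉ q
x∈p─q⇒x∉q (_ ∷ p) (_ ∷ q) (there x∈p─q) (there x∈q) = x∈p─q⇒x∉q p q x∈p─q x∈q

x∉p-x : ∀ {n} (p : Subset n) (x : Fin n) → x ∉ p - x
x∉p-x p x x∈ = x∈p─q⇒x∉q p ⁅ x ⁆ x∈ (x∈⁅x⁆ x)

x∈p⇒∣p∣≡1+∣p-x∣ : ∀ {n} {p : Subset n} {x} → x ∈ p → ∣ p ∣ ≡ suc ∣ p - x ∣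
x∈p⇒∣p∣≡1+∣p-x∣ {p = inside ∷ p}  here        = cong (suc ∘ ∣_∣) (≡-sym (p─⊥≡p p))
x∈p⇒∣p∣≡1+∣p-x∣ {p = inside ∷ p}  (there x∈p) = cong suc (x∈p⇒∣p∣≡1+∣p-x∣ x∈p)
x∈p⇒∣p∣≡1+∣p-x∣ {p = outside ∷ p} (there x∈p) = x∈p⇒∣p∣≡1+∣p-x∣ x∈p

disjoint⇒∣p∪q∣≡∣p∣+∣q∣ : ∀ {n} (p q : Subset n) → (∀ {x} → x ∈ p → x ∉ q) →
                        ∣ p ∪ q ∣ ≡ ∣ p ∣ + ∣ q ∣
disjoint⇒∣p∪q∣≡∣p∣+∣q∣ []            []            _   = refl
disjoint⇒∣p∪q∣≡∣p∣+∣q∣ (inside ∷ p)  (inside ∷ q)  dis = contradiction here (dis here)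
disjoint⇒∣p∪q∣≡∣p∣+∣q∣ (inside ∷ p)  (outside ∷ q) dis =
  cong suc (disjoint⇒∣p∪q∣≡∣p∣+∣q∣ p q λ x∈p x∈q → dis (there x∈p) (there x∈q))
disjoint⇒∣p∪q∣≡∣p∣+∣q∣ (outside ∷ p) (inside ∷ q)  dis =
  trans (cong suc (disjoint⇒∣p∪q∣≡∣p∣+∣q∣ p q λ x∈p x∈q → dis (there x∈p) (there x∈q)))
        (≡-sym (+-suc ∣ p ∣ ∣ q ∣))
disjoint⇒∣p∪q∣≡∣p∣+∣q∣ (outside ∷ p) (outside ∷ q) dis =
  disjoint⇒∣p∪q∣≡∣p∣+∣q∣ p q λ x∈p x∈q → dis (there x∈p) (there x∈q)

-- Used to pad a minimum forcing set to exactly `k` vertices.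
extendToSize : ∀ {n} (p : Subset n) k → ∣ p ∣ ≤ k → k ≤ n → ∃[ q ] p ⊆ q × ∣ q ∣ ≡ k
extendToSize []            zero    _     _   = [] , id , refl
extendToSize (inside ∷ p)  (suc k) p≤k   k≤n =
  let q , p⊆q , ∣q∣≡k = extendToSize p k (s≤s⁻¹ p≤k) (s≤s⁻¹ k≤n)
  in inside ∷ q , in⊆in p⊆q , cong suc ∣q∣≡k
extendToSize {suc n} (outside ∷ p) k p≤k k≤1+n with k ≤? n
... | yes k≤n =
  let q , p⊆q , ∣q∣≡k = extendToSize p k p≤k k≤n
  in outside ∷ q , out⊆ p⊆q , ∣q∣≡k
-- Here `k` equals `suc n`, so every position is needed: the tail is filled up to size `n` and the
-- head is added.
... | no  k≰n =
  let q , p⊆q , ∣q∣≡n = extendToSize p n (∣p∣≤n p) ≤-refl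
  in inside ∷ q , out⊆ p⊆q , trans (cong suc ∣q∣≡n) (≤-antisym (≰⇒> k≰n) k≤1+n)

-- Exchanging one element of a subset.

exchange : ∀ {n} → Subset n → Fin n → Fin n → Subset n
exchange B u w = (B - u) ∪ ⁅ w ⁆

module _ {n : ℕ} {B : Subset n} {u w : Fin n} where

  w∈exchange : w ∈ exchange B u w
  w∈exchange = q⊆p∪q (B - u) ⁅ w ⁆ (x∈⁅x⁆ w)

  ∈⇒∈exchange : ∀ {x} → x ∈ B → x ≢ u → x ∈ exchange B u w
  ∈⇒∈exchange x∈B x≢u = p⊆p∪q ⁅ w ⁆ (x∈p∧x≢y⇒x∈p-y x∈B x≢u)

  ∈exchange⇒ : ∀ {x} → x ∈ exchange B u w → (x ∈ B × x ≢ u) ⊎ x ≡ w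
  ∈exchange⇒ x∈ with x∈p∪q⁻ (B - u) ⁅ w ⁆ x∈
  ... | inj₁ x∈B-u = inj₁ (p─q⊆p B ⁅ u ⁆ x∈B-u , λ { refl → x∉p-x B u x∈B-u })
  ... | inj₂ x∈⁅w⁆ = inj₂ (x∈⁅y⁆⇒x≡y w x∈⁅w⁆)

  ∣exchange∣ : u ∈ B → w ∉ B → ∣ exchange B u w ∣ ≡ ∣ B ∣
  ∣exchange∣ u∈B w∉B = begin
    ∣ (B - u) ∪ ⁅ w ⁆ ∣   ≡⟨ disjoint⇒∣p∪q∣≡∣p∣+∣q∣ (B - u) ⁅ w ⁆ disjoint ⟩
    ∣ B - u ∣ + ∣ ⁅ w ⁆ ∣ ≡⟨ cong (∣ B - u ∣ +_) (∣⁅x⁆∣≡1 w) ⟩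
    ∣ B - u ∣ + 1         ≡⟨ +-comm ∣ B - u ∣ 1 ⟩
    suc ∣ B - u ∣         ≡⟨ x∈p⇒∣p∣≡1+∣p-x∣ u∈B ⟨
    ∣ B ∣                 ∎
    where
    open ≡-Reasoning
    disjoint : ∀ {x} → x ∈ B - u → x ∉ ⁅ w ⁆
    disjoint x∈B-u x∈⁅w⁆ with refl ← x∈⁅y⁆⇒x≡y w x∈⁅w⁆ = w∉B (p─q⊆p B ⁅ u ⁆ x∈B-u)

-- Removing the larger half leaves at most the smaller half. It is applied with `m` the number of
-- white vertices and `s` the size of the part still to be treated.
⌈m/2⌉≤s⇒m∸s≤⌈m/2⌉ : ∀ m s → ⌈ m /2⌉ ≤ s → m ∸ s ≤ ⌈ m /2⌉
⌈m/2⌉≤s⇒m∸s≤⌈m/2⌉ m s c≤s = begin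
  m ∸ s                             ≤⟨ ∸-monoʳ-≤ m c≤s ⟩
  m ∸ ⌈ m /2⌉                       ≡⟨ cong (_∸ ⌈ m /2⌉) (⌊n/2⌋+⌈n/2⌉≡n m) ⟨
  ⌊ m /2⌋ + ⌈ m /2⌉ ∸ ⌈ m /2⌉       ≡⟨ m+n∸n≡m ⌊ m /2⌋ ⌈ m /2⌉ ⟩
  ⌊ m /2⌋                           ≤⟨ ⌊n/2⌋≤⌈n/2⌉ m ⟩
  ⌈ m /2⌉                           ∎
  where open ≤-Reasoning

module _ {n : ℕ} (G : Graph n) where

  -- Connectivity and components.

  Adj-sym : ∀ {u v} → Adj G u v → Adj G v u
  Adj-sym {u} {v} = subst T (sym G u v)

  Conn-source : ∀ {W w x} → Conn G W w x → W w
  Conn-source (here Ww)    = Ww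
  Conn-source (step c _ _) = Conn-source c

  Conn-target : ∀ {W w x} → Conn G W w x → W x
  Conn-target (here Ww)     = Ww
  Conn-target (step _ Wx _) = Wx

  Conn-map : ∀ {W W′ : Fin n → Set} {w x} → (∀ {v} → W v → W′ v) → Conn G W w x → Conn G W′ w x
  Conn-map f (here Ww)     = here (f Ww)
  Conn-map f (step c Wx a) = step (Conn-map f c) (f Wx) a

  -- A component is held as a `Subset`, so that it has a cardinality and decidable membership, which
  -- `Conn` alone does not give.
  record IsComponent (W : Fin n → Set) (w : Fin n) (C : Subset n) : Set where
    field
      base      : w ∈ C
      connected : ∀ {x} → x ∈ C → Conn G W w x
      closed    : ∀ {x y} → x ∈ C → W y → Adj G x y → y ∈ C

    complete : ∀ {x} → Conn G W w x → x ∈ C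
    complete (here _)      = base
    complete (step c Wx a) = closed (complete c) Wx a

  -- Saturation from the singleton of `w`: adjacent vertices of `W` are added until none is left.
  -- The fuel `m` bounds the room `n ∸ ∣ C ∣`, which shrinks with every addition.
  component : ∀ {W : Fin n → Set} {w} → Decidable W → W w → ∃ (IsComponent W w)
  component {W} {w} W? Ww = grow n ⁅ w ⁆ (x∈⁅x⁆ w) connected₀ (m∸n≤m n ∣ ⁅ w ⁆ ∣)
    where
    connected₀ : ∀ {x} → x ∈ ⁅ w ⁆ → Conn G W w x
    connected₀ x∈ with refl ← x∈⁅y⁆⇒x≡y w x∈ = here Ww

    grow : ∀ m C → w ∈ C → (∀ {x} → x ∈ C → Conn G W w x) → n ∸ ∣ C ∣ ≤ m → ∃ (IsComponent W w)
    grow m C w∈C conn bound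
      with any? (λ y → W? y ×-dec ¬? (y ∈? C) ×-dec any? (λ x → (x ∈? C) ×-dec T? (adj G x y)))
    ... | no none = C , record
      { base      = w∈C
      ; connected = conn
      ; closed    = λ {x} {y} x∈C Wy x~y →
          decidable-stable (y ∈? C) λ y∉C → none (y , Wy , y∉C , x , x∈C , x~y)
      }
    ... | yes (y , Wy , y∉C , x , x∈C , x~y) = enlarge m bound
      where
      C′ = C ∪ ⁅ y ⁆
      C⊂C′ : ∣ C ∣ < ∣ C′ ∣
      C⊂C′ = p⊂q⇒∣p∣<∣q∣ (p⊆p∪q ⁅ y ⁆ , y , q⊆p∪q C ⁅ y ⁆ (x∈⁅x⁆ y) , y∉C)
      conn′ : ∀ {z} → z ∈ C′ → Conn G W w z
      conn′ z∈ with x∈p∪q⁻ C ⁅ y ⁆ z∈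
      ... | inj₁ z∈C = conn z∈C
      ... | inj₂ z∈⁅y⁆ with refl ← x∈⁅y⁆⇒x≡y y z∈⁅y⁆ = step (conn x∈C) Wy x~y
      smaller : n ∸ ∣ C′ ∣ < n ∸ ∣ C ∣
      smaller = ∸-monoʳ-< C⊂C′ (∣p∣≤n C′)
      enlarge : ∀ m → n ∸ ∣ C ∣ ≤ m → ∃ (IsComponent W w)
      enlarge zero    b = contradiction (<-≤-trans smaller b) λ ()
      enlarge (suc m) b = grow m C′ (p⊆p∪q ⁅ y ⁆ w∈C) conn′ (s≤s⁻¹ (<-≤-trans smaller b))

  -- Decidable connectivity makes forces and colours decidable; `someForceIn` searches for a force
  -- and `BlueAt-shift` branches on a colour.
  Conn? : ∀ {W : Fin n → Set} → Decidable W → ∀ w x → Dec (Conn G W w x)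
  Conn? W? w x with W? w
  ... | no ¬Ww = no (¬Ww ∘ Conn-source)
  ... | yes Ww with C , isC ← component W? Ww = map′ connected complete (x ∈? C)
    where open IsComponent isC

  -- Decidability and monotonicity of propagation.

  Forces? : ∀ {Blue : Fin n → Set} → Decidable Blue → ∀ u w → Dec (Forces G Blue u w)
  Forces? Blue? u w =
    Blue? u ×-dec ¬? (Blue? w) ×-dec T? (adj G u w) ×-dec
    all? (λ x → ¬? (Blue? x) →-dec T? (adj G u x) →-dec Conn? (¬? ∘ Blue?) w x →-dec (x ≟ᶠ w))

  BlueAt? : ∀ B i → Decidable (BlueAt G B i)
  BlueAt? B zero    v = v ∈? B
  BlueAt? B (suc i) v = BlueAt? B i v ⊎-dec any? (λ u → Forces? (BlueAt? B i) u v)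

  -- More blue vertices mean fewer white walks, so competitors of `w` can only disappear.
  Forces-mono : ∀ {Blue Blue′ : Fin n → Set} {u w} → (∀ {v} → Blue v → Blue′ v) → ¬ Blue′ w →
                Forces G Blue u w → Forces G Blue′ u w
  Forces-mono f ¬w (bu , _ , u~w , unique) =
    f bu , ¬w , u~w , λ x ¬x u~x c → unique x (¬x ∘ f) u~x (Conn-map (_∘ f) c)

  BlueAt-shift : ∀ {B B′ j} → (∀ {v} → v ∈ B′ → BlueAt G B j v) →
                 ∀ i {v} → BlueAt G B′ i v → BlueAt G B (i + j) v
  BlueAt-shift f zero    v∈B′            = f v∈B′
  BlueAt-shift f (suc i) (inj₁ b)        = inj₁ (BlueAt-shift f i b)
  -- Starting from `B`, the vertex `v` may already be blue, and then it is no longer a legal target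
  -- of a force.
  BlueAt-shift {B} {B′} {j} f (suc i) {v} (inj₂ (u , F)) with BlueAt? B (i + j) v
  ... | yes b = inj₁ b
  ... | no ¬b = inj₂ (u , Forces-mono (BlueAt-shift f i) ¬b F)

  BlueAt-≤ : ∀ {B i j v} → i ≤ j → BlueAt G B i v → BlueAt G B j v
  BlueAt-≤ {B} {i} {j} {v} i≤j b = subst (λ t → BlueAt G B t v) (m∸n+n≡m i≤j) (later (j ∸ i) b)
    where
    later : ∀ {i v} d → BlueAt G B i v → BlueAt G B (d + i) v
    later zero    b = b
    later (suc d) b = inj₁ (later d b)

  IsPSDForcingSet-shift : ∀ {B B′ j} → (∀ {v} → v ∈ B′ → BlueAt G B j v) →
                          IsPSDForcingSet G B′ → IsPSDForcingSet G B
  IsPSDForcingSet-shift f (t , all) = _ , λ v → BlueAt-shift f t (all v)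

  -- Unions of white components.

  -- X is a union of components of G - B.
  record Separated (B X : Subset n) : Set where
    field
      white  : ∀ {x} → x ∈ X → x ∉ B
      closed : ∀ {x y} → x ∈ X → Adj G x y → y ∈ X ⊎ y ∈ B

  module _ {B X : Subset n} (sep : Separated B X) where
    open Separated sep

    Separated-Conn : ∀ {w x} → w ∈ X → Conn G (_∉ B) w x → Conn G (_∈ X) w x
    Separated-Conn w∈X (here _) = here w∈X
    Separated-Conn w∈X (step c x∉B y~x) with c′ ← Separated-Conn w∈X c =
      step c′ ([ id , (λ x∈B → contradiction x∈B x∉B) ]′ (closed (Conn-target c′) y~x)) y~x

    Separated-∁ : Separated B (∁ (X ∪ B))
    Separated-∁ = record
      { white  = λ x∈ x∈B → x∈∁p⇒x∉p x∈ (q⊆p∪q X B x∈B)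
      ; closed = closed′
      }
      where
      closed′ : ∀ {x y} → x ∈ ∁ (X ∪ B) → Adj G x y → y ∈ ∁ (X ∪ B) ⊎ y ∈ B
      closed′ {x} {y} x∈ x~y with y ∈? B | y ∈? X
      ... | yes y∈B | _       = inj₂ y∈B
      ... | no  y∉B | yes y∈X =
        contradiction (x∈p∪q⁺ (closed y∈X (Adj-sym x~y))) (x∈∁p⇒x∉p x∈)
      ... | no  y∉B | no  y∉X = inj₁ (x∉p⇒x∈∁p ([ y∉X , y∉B ]′ ∘ x∈p∪q⁻ X B))

    Separated-insert : ∀ w → Separated (B ∪ ⁅ w ⁆) (X - w)
    Separated-insert w = record { white = white′ ; closed = closed′ }
      where
      white′ : ∀ {x} → x ∈ X - w → x ∉ B ∪ ⁅ w ⁆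
      white′ x∈ x∈′ with x∈p∪q⁻ B ⁅ w ⁆ x∈′
      ... | inj₁ x∈B   = white (p─q⊆p X ⁅ w ⁆ x∈) x∈B
      ... | inj₂ x∈⁅w⁆ = x∈p─q⇒x∉q X ⁅ w ⁆ x∈ x∈⁅w⁆
      closed′ : ∀ {x y} → x ∈ X - w → Adj G x y → y ∈ X - w ⊎ y ∈ B ∪ ⁅ w ⁆
      closed′ {x} {y} x∈ x~y with y ∈? ⁅ w ⁆ | closed (p─q⊆p X ⁅ w ⁆ x∈) x~y
      ... | yes y∈⁅w⁆ | _        = inj₂ (q⊆p∪q B ⁅ w ⁆ y∈⁅w⁆)
      ... | no  y∉⁅w⁆ | inj₁ y∈X = inj₁ (x∈p∧x∉q⇒x∈p─q y∈X y∉⁅w⁆)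
      ... | no  y∉⁅w⁆ | inj₂ y∈B = inj₂ (p⊆p∪q ⁅ w ⁆ y∈B)

    Separated-─ : ∀ {C} → Separated B C → Separated B (X ─ C)
    Separated-─ {C} sepC = record { white = white ∘ p─q⊆p X C ; closed = closed′ }
      where
      closed′ : ∀ {x y} → x ∈ X ─ C → Adj G x y → y ∈ X ─ C ⊎ y ∈ B
      closed′ {x} {y} x∈ x~y with y ∈? C | closed (p─q⊆p X C x∈) x~y
      ... | _       | inj₂ y∈B = inj₂ y∈B
      ... | no  y∉C | inj₁ y∈X = inj₁ (x∈p∧x∉q⇒x∈p─q y∈X y∉C)
      ... | yes y∈C | inj₁ y∈X with Separated.closed sepC y∈C (Adj-sym x~y)
      ...   | inj₁ x∈C = contradiction x∈C (x∈p─q⇒x∉q X C x∈)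
      ...   | inj₂ x∈B = contradiction x∈B (white (p─q⊆p X C x∈))

    -- The forces inside X do not depend on the colours outside X ∪ B, so if B forces
    -- nothing in X then X stays white forever.
    someForceIn : Nonempty X → IsPSDForcingSet G B → ∃[ u ] ∃[ w ] w ∈ X × Forces G (_∈ B) u w
    someForceIn (x₀ , x₀∈X) (t , allBlue)
      with any? (λ u → any? (λ w → (w ∈? X) ×-dec Forces? (_∈? B) u w))
    ... | yes found = found
    ... | no  none  = contradiction (allBlue x₀) (staysWhite t x₀∈X)
      where
      staysWhite : ∀ i {x} → x ∈ X → ¬ BlueAt G B i x
      staysWhite zero    x∈X x∈B      = white x∈X x∈B
      staysWhite (suc i) x∈X (inj₁ b) = staysWhite i x∈X b
      staysWhite (suc i) {w} w∈X (inj₂ (u , bu , ¬bw , u~w , unique))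
        with closed w∈X (Adj-sym u~w)
      ... | inj₁ u∈X = staysWhite i u∈X bu
      ... | inj₂ u∈B = none (u , w , w∈X , u∈B , white w∈X , u~w , λ x _ u~x c →
            let c′ = Separated-Conn w∈X c in
            unique x (staysWhite i (Conn-target c′)) u~x (Conn-map (staysWhite i) c′))

  -- While `X` is nonempty some vertex of it can be forced. Only one such force per time step is
  -- used: its target joins `B` and leaves `X`, and monotonicity carries the result back to the
  -- actual process.
  blueWithinSize : ∀ m {B X} → Separated B X → IsPSDForcingSet G B → ∣ X ∣ ≤ m →
                   ∀ {v} → v ∈ X → BlueAt G B m v
  blueWithinSize zero {X = X} sep forcing ∣X∣≤0 {v} v∈X =
    contradiction (≤-trans (≤-reflexive (≡-sym (x∈p⇒∣p∣≡1+∣p-x∣ v∈X))) ∣X∣≤0) λ ()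
  blueWithinSize (suc m) {B} {X} sep forcing ∣X∣≤1+m {v} v∈X
    with u , w , w∈X , F ← someForceIn sep (v , v∈X) forcing = blue (v ≟ᶠ w)
    where
    oneStep : ∀ {x} → x ∈ B ∪ ⁅ w ⁆ → BlueAt G B 1 x
    oneStep x∈ with x∈p∪q⁻ B ⁅ w ⁆ x∈
    ... | inj₁ x∈B = inj₁ x∈B
    ... | inj₂ x∈⁅w⁆ with refl ← x∈⁅y⁆⇒x≡y w x∈⁅w⁆ = inj₂ (u , F)

    later : ∀ {x} → BlueAt G (B ∪ ⁅ w ⁆) m x → BlueAt G B (suc m) x
    later {x} b = subst (λ t → BlueAt G B t x) (+-comm m 1) (BlueAt-shift oneStep m b)

    forcing′ : IsPSDForcingSet G (B ∪ ⁅ w ⁆)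
    -- Delay 0: any superset of a forcing set is a forcing set.
    forcing′ = IsPSDForcingSet-shift {j = 0} (p⊆p∪q ⁅ w ⁆) forcing

    blue : Dec (v ≡ w) → BlueAt G B (suc m) v
    blue (yes refl) = BlueAt-≤ (s≤s z≤n) (oneStep (q⊆p∪q B ⁅ w ⁆ (x∈⁅x⁆ w)))
    blue (no  v≢w)  = later (blueWithinSize m (Separated-insert sep w) forcing′
      (s≤s⁻¹ (≤-trans (x∈p⇒∣p-x∣<∣p∣ w∈X) ∣X∣≤1+m)) (x∈p∧x≢y⇒x∈p-y v∈X v≢w))

  -- Exchange along a force and its reversal.

  component-Separated : ∀ {B C w} → IsComponent (_∉ B) w C → Separated B C
  component-Separated {B} {C} isC = record { white = Conn-target ∘ connected ; closed = closed′ }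
    where
    open IsComponent isC
    closed′ : ∀ {x y} → x ∈ C → Adj G x y → y ∈ C ⊎ y ∈ B
    closed′ {y = y} x∈C x~y with y ∈? B
    ... | yes y∈B = inj₂ y∈B
    ... | no  y∉B = inj₁ (closed x∈C y∉B x~y)

  module _ {B C : Subset n} {u w : Fin n} (isC : IsComponent (_∉ B) w C) (F : Forces G (_∈ B) u w) where
    open IsComponent isC using (base; connected)
    open Separated (component-Separated isC)

    private
      B′ : Subset n
      B′ = exchange B u w

      u∈B : u ∈ B
      u∈B = proj₁ F

      w∉B : w ∉ B
      w∉B = proj₁ (proj₂ F)

      u~w : Adj G u w
      u~w = proj₁ (proj₂ (proj₂ F))

      onlyNeighbour : ∀ {x} → x ∈ C → Adj G u x → x ≡ w
      onlyNeighbour x∈C u~x = proj₂ (proj₂ (proj₂ F)) _ (white x∈C) u~x (connected x∈C)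

      ∉B′⇒∈B⇒≡u : ∀ {x} → x ∉ B′ → x ∈ B → x ≡ u
      ∉B′⇒∈B⇒≡u {x} x∉B′ x∈B =
        decidable-stable (x ≟ᶠ u) λ x≢u → x∉B′ (∈⇒∈exchange x∈B x≢u)

    -- Turning `u` white opens no way out of `C - w`, since the only neighbour of `u` in `C` is `w`,
    -- which is now blue.
    exchange-Separated : Separated B′ (C - w)
    exchange-Separated = record { white = white′ ; closed = closed′ }
      where
      C-w⊆C : C - w ⊆ C
      C-w⊆C = p─q⊆p C ⁅ w ⁆
      white′ : ∀ {x} → x ∈ C - w → x ∉ B′
      white′ x∈ x∈B′ with ∈exchange⇒ x∈B′
      ... | inj₁ (x∈B , _) = white (C-w⊆C x∈) x∈B
      ... | inj₂ refl      = x∉p-x C w x∈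
      closed′ : ∀ {x y} → x ∈ C - w → Adj G x y → y ∈ C - w ⊎ y ∈ B′
      closed′ {x} {y} x∈ x~y with y ≟ᶠ w | y ≟ᶠ u | closed (C-w⊆C x∈) x~y
      ... | yes refl | _        | _        = inj₂ w∈exchange
      ... | no  y≢w  | _        | inj₁ y∈C = inj₁ (x∈p∧x≢y⇒x∈p-y y∈C y≢w)
      ... | no  y≢w  | no  y≢u  | inj₂ y∈B = inj₂ (∈⇒∈exchange y∈B y≢u)
      ... | no  y≢w  | yes refl | inj₂ y∈B with refl ← onlyNeighbour (C-w⊆C x∈) (Adj-sym x~y) =
        contradiction x∈ (x∉p-x C w)

    reverseForce : Forces G (_∈ B′) w u
    reverseForce = w∈exchange , u∉B′ , Adj-sym u~w , unique
      where
      u∉B′ : u ∉ B′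
      u∉B′ u∈B′ with ∈exchange⇒ u∈B′
      ... | inj₁ (_ , u≢u) = u≢u refl
      ... | inj₂ refl      = w∉B u∈B

      -- A white walk from `u` could enter `C` only from a vertex of `B` that is now white, hence
      -- from `u` itself, and then only at `w`, which is blue. So white neighbours of `w` in `C` do
      -- not compete with `u`.
      avoidsC : ∀ {x} → Conn G (_∉ B′) u x → x ∉ C
      avoidsC (here _) u∈C = white u∈C u∈B
      avoidsC (step c x∉B′ y~x) x∈C with closed x∈C (Adj-sym y~x)
      ... | inj₁ y∈C = avoidsC c y∈C
      ... | inj₂ y∈B with refl ← ∉B′⇒∈B⇒≡u (Conn-target c) y∈B
        with refl ← onlyNeighbour x∈C y~x = x∉B′ w∈exchange

      unique : ∀ x → x ∉ B′ → Adj G w x → Conn G (_∉ B′) u x → x ≡ u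
      unique x x∉B′ w~x c with closed base w~x
      ... | inj₁ x∈C = contradiction x∈C (avoidsC c)
      ... | inj₂ x∈B = ∉B′⇒∈B⇒≡u x∉B′ x∈B

    -- The reverse force restores `u` in the first step, so all of `B` is blue at time 1.
    exchange-forcing : IsPSDForcingSet G B → IsPSDForcingSet G B′
    exchange-forcing = IsPSDForcingSet-shift {j = 1} blueAt1
      where
      blueAt1 : ∀ {v} → v ∈ B → BlueAt G B′ 1 v
      blueAt1 {v} v∈B with v ≟ᶠ u
      ... | yes refl = inj₂ (w , reverseForce)
      ... | no  v≢u  = inj₁ (∈⇒∈exchange v∈B v≢u)

  -- The balancing recursion.

  -- The white vertices outside `X` again form a union of components, so their number bounds the
  -- time they need.
  blueOutside : ∀ {B X m} → Separated B X → IsPSDForcingSet G B → ∣ ∁ (X ∪ B) ∣ ≤ m →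
                ∀ {v} → v ∉ X → BlueAt G B m v
  blueOutside {B} {X} sep forcing bound {v} v∉X with v ∈? B
  ... | yes v∈B = BlueAt-≤ z≤n v∈B
  ... | no  v∉B = blueWithinSize _ (Separated-∁ sep) forcing bound
    (x∉p⇒x∈∁p ([ v∉X , v∉B ]′ ∘ x∈p∪q⁻ X B))

  module _ {k : ℕ} where
    private
      c : ℕ
      c = ⌈ (n ∸ k) /2⌉

    ∣∁∪∣≤half : ∀ {B X} → Separated B X → ∣ B ∣ ≡ k → c ≤ ∣ X ∣ → ∣ ∁ (X ∪ B) ∣ ≤ c
    ∣∁∪∣≤half {B} {X} sep refl c≤∣X∣ = begin
      ∣ ∁ (X ∪ B) ∣       ≡⟨ ∣∁p∣≡n∸∣p∣ (X ∪ B) ⟩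
      n ∸ ∣ X ∪ B ∣       ≡⟨ cong (n ∸_) (disjoint⇒∣p∪q∣≡∣p∣+∣q∣ X B (Separated.white sep)) ⟩
      n ∸ (∣ X ∣ + ∣ B ∣) ≡⟨ cong (n ∸_) (+-comm ∣ X ∣ ∣ B ∣) ⟩
      n ∸ (∣ B ∣ + ∣ X ∣) ≡⟨ ∸-+-assoc n ∣ B ∣ ∣ X ∣ ⟨
      n ∸ ∣ B ∣ ∸ ∣ X ∣   ≤⟨ ⌈m/2⌉≤s⇒m∸s≤⌈m/2⌉ (n ∸ ∣ B ∣) ∣ X ∣ c≤∣X∣ ⟩
      c                   ∎
      where open ≤-Reasoning

    -- The invariant is that everything outside `X` is blue by time `c`; the fuel `m` bounds the
    -- size of `X`, which drops in both branches.
    balance : ∀ m {B X} → ∣ B ∣ ≡ k → IsPSDForcingSet G B → Separated B X →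
              (∀ {v} → v ∉ X → BlueAt G B c v) → ∣ X ∣ ≤ m → PtKLE G k c
    balance m {B} {X} ∣B∣≡k forcing sep outsideBlue ∣X∣≤m with nonempty? X
    ... | no  X-empty = B , ∣B∣≡k , λ v → outsideBlue λ v∈X → X-empty (v , v∈X)
    balance zero ∣B∣≡k forcing sep outsideBlue ∣X∣≤m | yes (x , x∈X) =
      contradiction (≤-trans (≤-reflexive (≡-sym (x∈p⇒∣p∣≡1+∣p-x∣ x∈X))) ∣X∣≤m) λ ()
    balance (suc m) {B} {X} ∣B∣≡k forcing sep outsideBlue ∣X∣≤m | yes X-nonempty
      with u , w , w∈X , F@(u∈B , w∉B , _) ← someForceIn sep X-nonempty forcing
      with C , isC ← component (¬? ∘ (_∈? B)) w∉B
      with ∣ C ∣ ≤? c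
    ... | yes ∣C∣≤c = balance m ∣B∣≡k forcing (Separated-─ sep sepC) outsideBlue′
        (s≤s⁻¹ (≤-trans (p∩q≢∅⇒∣p─q∣<∣p∣ X C (w , x∈p∩q⁺ (w∈X , IsComponent.base isC))) ∣X∣≤m))
      where
      sepC : Separated B C
      sepC = component-Separated isC
      outsideBlue′ : ∀ {v} → v ∉ X ─ C → BlueAt G B c v
      outsideBlue′ {v} v∉ with v ∈? C
      ... | yes v∈C = blueWithinSize c sepC forcing ∣C∣≤c v∈C
      ... | no  v∉C = outsideBlue λ v∈X → v∉ (x∈p∧x∉q⇒x∈p─q v∈X v∉C)
    -- `outsideBlue` concerns the old set `B`, so the invariant is rebuilt for the exchanged set by
    -- counting. As `C` has more than `c` vertices, `C - w` still has at least `c`, which leaves at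
    -- most `c` white vertices elsewhere.
    ... | no  ∣C∣≰c = balance m ∣B′∣≡k forcing′ sep′
        (blueOutside sep′ forcing′ (∣∁∪∣≤half sep′ ∣B′∣≡k (s≤s⁻¹ (subst (c <_) ∣C∣≡1+∣C-w∣ (≰⇒> ∣C∣≰c)))))
        (s≤s⁻¹ (≤-trans (subst (_≤ ∣ X ∣) ∣C∣≡1+∣C-w∣ (p⊆q⇒∣p∣≤∣q∣ C⊆X)) ∣X∣≤m))
      where
      ∣C∣≡1+∣C-w∣ : ∣ C ∣ ≡ suc ∣ C - w ∣
      ∣C∣≡1+∣C-w∣ = x∈p⇒∣p∣≡1+∣p-x∣ (IsComponent.base isC)
      C⊆X : C ⊆ X
      C⊆X x∈C = Conn-target (Separated-Conn sep w∈X (IsComponent.connected isC x∈C))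
      ∣B′∣≡k : ∣ exchange B u w ∣ ≡ k
      ∣B′∣≡k = trans (∣exchange∣ u∈B w∉B) ∣B∣≡k
      forcing′ : IsPSDForcingSet G (exchange B u w)
      forcing′ = exchange-forcing isC F forcing
      sep′ : Separated (exchange B u w) (C - w)
      sep′ = exchange-Separated isC F

  ∁-Separated : ∀ B → Separated B (∁ B)
  ∁-Separated B = record { white = x∈∁p⇒x∉p ; closed = λ {x} {y} _ _ → side y }
    where
    side : ∀ y → y ∈ ∁ B ⊎ y ∈ B
    side y with y ∈? B
    ... | yes y∈B = inj₂ y∈B
    ... | no  y∉B = inj₁ (x∉p⇒x∈∁p y∉B)

theorem2p5 : ∀ (n : ℕ) (G : Graph n) (z k : ℕ) → IsZplus G z → z ≤ k → k ≤ n →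
    PtKLE G k ⌈ (n ∸ k) /2⌉
theorem2p5 n G z k ((B₀ , refl , forcing₀) , _) z≤k k≤n
  with B , B₀⊆B , ∣B∣≡k ← extendToSize B₀ k z≤k k≤n =
  -- Initially `X` is the whole white set, so the vertices outside it are blue at time 0.
  balance G ∣ ∁ B ∣ ∣B∣≡k (IsPSDForcingSet-shift G {j = 0} B₀⊆B forcing₀) (∁-Separated G B)
    (λ v∉∁B → BlueAt-≤ G z≤n (x∉∁p⇒x∈p v∉∁B)) ≤-refl
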